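{- Let $r\ge 1$ be an integer and $k=4r$. Let $G_r$ be the following $k$-terminal digraph: start from the undirected $(r+2)\times(r+2)$ grid graph (vertices $(i,j)$, $1\le i,j\le r+2$, row $i$ counted from top, column $j$ from left, adjacent iff $|i-i'|+|j-j'|=1$); delete the four corner vertices; declare the remaining $4r$ boundary vertices to be the terminals (so there are $r$ terminals on each side) and all $r^2$ interior vertices non-terminals; delete every edge joining two terminals; finally orient every horizontal edge from left to right and every vertical edge from top to bottom. Then $G_r$ is acyclic and every reachability-preserving minor of $G_r$ contains at least $r^2=(k/4)^2$ non-terminal vertices. In particular, for infinitely many $k$ there is a $k$-terminal acyclic directed grid for which every reachability-preserving minor has $\Omega(k^2)$ non-terminals.
   Context: A minor of a digraph $G$ is any digraph obtained from $G$ by a sequence of vertex deletions, edge deletions and edge contractions (contracting a directed edge $(u,v)$ identifies $u$ and $v$ into one vertex, discarding loops), where terminals are never deleted and no contraction identifies two terminals. A digraph $H$ containing the terminal set $K$ is a reachability-preserving minor of $G$ if $H$ is a minor of $G$ and for all $x,x'\in K$ there is a directed path from $x$ to $x'$ in $H$ if and only if there is one in $G$. -}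

module Defs where

open import Data.Bool.Base using (if_then_else_)
open import Data.Fin.Base as Fin using (Fin; toℕ)
import Data.Fin.Properties as Fin
open import Data.List.Base using (length; filter; allFin; cartesianProduct)
open import Data.Nat.Base using (ℕ; suc; _+_; ∣_-_∣)
import Data.Nat.Properties as ℕ
open import Data.Product.Base using (∃₂; _×_; _,_; proj₁; proj₂)
open import Data.Product.Properties using (≡-dec)
open import Data.Sum.Base using (_⊎_)
open import Function.Bundles using (_⇔_)
open import Level using (0ℓ)
open import Relation.Binary.Construct.Closure.ReflexiveTransitive using (Star)
open import Relation.Binary.Construct.Closure.Transitive using (TransClosure)
open import Relation.Binary.Core using (Rel)
open import Relation.Binary.Definitions using (DecidableEquality)
open import Relation.Binary.PropositionalEquality.Core using (_≡_; _≢_; refl)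
open import Relation.Nullary.Decidable.Core using (yes; no; does; _×-dec_; _⊎-dec_; ¬?)
open import Relation.Nullary.Negation.Core using (¬_)
open import Relation.Unary using (Pred; Decidable; _⊆_; _∉_; _∈_)

-- Simple digraphs whose vertices are drawn from a universe U of names.
-- Vertices keep their names under minor operations, so that a minor
-- containing the terminals contains them literally.

record Digraph (U : Set) : Set₁ where
  field
    V        : Pred U 0ℓ
    V?       : Decidable V
    E        : Rel U 0ℓ
    E⇒V      : ∀ {x y} → E x y → V x × V y
    loopless : ∀ {x} → ¬ E x x

  Reachable : Rel U 0ℓ
  Reachable = Star E

  Acyclic : Set
  Acyclic = ∀ x → ¬ TransClosure E x x

open Digraph public using (Reachable; Acyclic)

record TerminalDigraph (U : Set) : Set₁ where
  field
    digraph : Digraph U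
    K       : Pred U 0ℓ
    K?      : Decidable K
    K⊆V     : K ⊆ Digraph.V digraph

open TerminalDigraph public using (digraph)

module Operations {U : Set} (_≟_ : DecidableEquality U) (G : Digraph U) where
  open Digraph G

  deleteVertex : U → Digraph U
  deleteVertex v = record
    { V        = λ x → V x × x ≢ v
    ; V?       = λ x → V? x ×-dec ¬? (x ≟ v)
    ; E        = λ x y → E x y × x ≢ v × y ≢ v
    ; E⇒V      = λ (e , x≢v , y≢v) → (proj₁ (E⇒V e) , x≢v) , (proj₂ (E⇒V e) , y≢v)
    ; loopless = λ (e , _) → loopless e
    }

  deleteEdge : U → U → Digraph U
  deleteEdge u v = record
    { V        = V
    ; V?       = V?
    ; E        = λ x y → E x y × ¬ (x ≡ u × y ≡ v)
    ; E⇒V      = λ (e , _) → E⇒V e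
    ; loopless = λ (e , _) → loopless e
    }

  rename : U → U → U → U
  rename a b x = if does (x ≟ a) then b else x

  private
    rename-V : ∀ {a b x} → V b → b ≢ a → V x → V (rename a b x) × rename a b x ≢ a
    rename-V {a} {b} {x} Vb b≢a Vx with x ≟ a
    ... | yes _   = Vb , b≢a
    ... | no  x≢a = Vx , x≢a

  -- The vertices a and b become one vertex, which is called b.
  identify : (a b : U) → V b → b ≢ a → Digraph U
  identify a b Vb b≢a = record
    { V        = λ x → V x × x ≢ a
    ; V?       = λ x → V? x ×-dec ¬? (x ≟ a)
    ; E        = λ x y → x ≢ y ×
                   ∃₂ λ x′ y′ → E x′ y′ × rename a b x′ ≡ x × rename a b y′ ≡ y
    ; E⇒V      = λ { (_ , _ , _ , e , refl , refl) →
                     rename-V Vb b≢a (proj₁ (E⇒V e)) , rename-V Vb b≢a (proj₂ (E⇒V e)) }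
    ; loopless = λ (x≢x , _) → x≢x refl
    }

  -- Contraction of the edge (u , v), the merged vertex being called u, resp. v.
  contractInto-tail contractInto-head : ∀ {u v} → E u v → Digraph U
  contractInto-tail {u} {v} e =
    identify v u (proj₁ (E⇒V e)) λ { refl → loopless e }
  contractInto-head {u} {v} e =
    identify u v (proj₂ (E⇒V e)) λ { refl → loopless e }

module Minors {U : Set} (_≟_ : DecidableEquality U) (T : TerminalDigraph U) where
  open TerminalDigraph T using (K)
  open Operations _≟_

  -- A merged vertex that comes from a terminal must keep the terminal's name.
  -- Hence the name that disappears is always that of a non-terminal, which
  -- is possible exactly when the contracted edge does not join two terminals.
  data IsMinor : Pred (Digraph U) (Level.suc 0ℓ) where
    start     : IsMinor (digraph T)
    delVertex : ∀ {H v} → IsMinor H → Digraph.V H v → v ∉ K →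
                IsMinor (deleteVertex H v)
    delEdge   : ∀ {H u v} → IsMinor H → Digraph.E H u v →
                IsMinor (deleteEdge H u v)
    contractₜ : ∀ {H u v} → IsMinor H → (e : Digraph.E H u v) → v ∉ K →
                IsMinor (contractInto-tail H e)
    contractₕ : ∀ {H u v} → IsMinor H → (e : Digraph.E H u v) → u ∉ K →
                IsMinor (contractInto-head H e)

  record IsReachabilityPreservingMinor (H : Digraph U) : Set₁ where
    field
      isMinor   : IsMinor H
      K⊆V       : K ⊆ Digraph.V H
      reachable : ∀ {x y} → x ∈ K → y ∈ K →
                  Reachable H x y ⇔ Reachable (digraph T) x y

-- (i , j) is the position in row i (from the top) and column j (from the
-- left) of a grid with m rows and n columns; both are counted from 0.
Position : ℕ → ℕ → Set
Position m n = Fin m × Fin n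

_≟ₚ_ : ∀ {m n} → DecidableEquality (Position m n)
_≟ₚ_ = ≡-dec Fin._≟_ Fin._≟_

module _ {m n : ℕ} where

  open Minors {Position m n} _≟ₚ_ public using (IsReachabilityPreservingMinor)

  count : {P : Pred (Position m n) 0ℓ} → Decidable P → ℕ
  count P? = length (filter P? (cartesianProduct (allFin m) (allFin n)))

  #terminals : TerminalDigraph (Position m n) → ℕ
  #terminals T = count (TerminalDigraph.K? T)

  -- The number of vertices of H that are not terminals of T.
  #nonTerminals : TerminalDigraph (Position m n) → Digraph (Position m n) → ℕ
  #nonTerminals T H = count λ p → Digraph.V? H p ×-dec ¬? (TerminalDigraph.K? T p)

Extreme : ∀ {n} → Pred (Fin n) 0ℓ
Extreme {n} i = toℕ i ≡ 0 ⊎ suc (toℕ i) ≡ n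

extreme? : ∀ {n} → Decidable (Extreme {n})
extreme? {n} i = (toℕ i ℕ.≟ 0) ⊎-dec (suc (toℕ i) ℕ.≟ n)

module _ {m n : ℕ} where

  Corner Boundary : Pred (Position m n) 0ℓ
  Corner   (i , j) = Extreme i × Extreme j
  Boundary (i , j) = Extreme i ⊎ Extreme j

  corner? : Decidable Corner
  corner? (i , j) = extreme? i ×-dec extreme? j

  boundary? : Decidable Boundary
  boundary? (i , j) = extreme? i ⊎-dec extreme? j

  Adjacent : Rel (Position m n) 0ℓ
  Adjacent (i , j) (i′ , j′) = ∣ toℕ i - toℕ i′ ∣ + ∣ toℕ j - toℕ j′ ∣ ≡ 1

  Rightward Downward : Rel (Position m n) 0ℓ
  Rightward (i , j) (i′ , j′) = i ≡ i′ × j Fin.< j′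
  Downward  (i , j) (i′ , j′) = j ≡ j′ × i Fin.< i′

  -- An orientation of the grid graph, where vertices on the boundary and
  -- edges between two boundary vertices may be missing.
  record IsDirectedGrid (G : Digraph (Position m n)) : Set where
    open Digraph G
    field
      adjacent : ∀ {p q} → E p q → Adjacent p q
      oriented : ∀ {p q} → E p q → ¬ E q p
      interior : ∀ {p} → ¬ Boundary p → V p
      complete : ∀ {p q} → V p → V q → Adjacent p q →
                 ¬ (Boundary p × Boundary q) → E p q ⊎ E q p

module _ (r : ℕ) where
  private
    Pos : Set
    Pos = Position (r + 2) (r + 2)

  Terminal : Pred Pos 0ℓ
  Terminal p = Boundary p × ¬ Corner p

  𝔾 : TerminalDigraph Pos
  𝔾 = record
    { digraph = record
      { V        = λ p → ¬ Corner p
      ; V?       = λ p → ¬? (corner? p)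
      ; E        = λ p q → (¬ Corner p × ¬ Corner q)
                         × Adjacent p q
                         × (Rightward p q ⊎ Downward p q)
                         × ¬ (Terminal p × Terminal q)
      ; E⇒V      = proj₁
      ; loopless = λ {p} (_ , adj , _) → irreflexive p adj
      }
    ; K    = Terminal
    ; K?   = λ p → boundary? p ×-dec ¬? (corner? p)
    ; K⊆V  = proj₂
    }
    where
    irreflexive : ∀ p → ¬ Adjacent p p
    irreflexive (i , j) adj
      rewrite ℕ.∣n-n∣≡0 (toℕ i) | ℕ.∣n-n∣≡0 (toℕ j) with () ← adj

{-# OPTIONS --safe #-}

-- Edges of the grid go right or down, so no row is reachable from a lower one
-- and no column from one further right.  Let H be a reachability-preserving
-- minor.  Paths of H joining the ends of two different rows are disjoint: a
-- common vertex would let the lower row reach the upper one.  The same holds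
-- for columns.  By planarity a left-right and a top-bottom path of H always
-- meet, and monotonicity forbids that they meet in a terminal, so the r²
-- meeting points are distinct non-terminals.
--
-- Planarity enters as a crossing property of undirected walks.  It passes to
-- minors because a walk inside a set A of vertices of a contraction lifts to a
-- walk inside the preimage of A.  In the grid it holds by a parity argument:
-- continue a left-right walk straight down from its end; how often it crosses
-- the ray from b to the right does not change modulo 2 while b moves along a
-- walk that avoids it, but this number is even for b in the top row and odd
-- for b below the grid.

module Submission where

open import Defs
open import Algebra.Bundles using (CommutativeRing)
import Algebra.Properties.CommutativeSemigroup as CommutativeSemigroupProperties
open import Data.Bool.Base using (Bool; true; false; _∧_; _xor_)
open import Data.Bool.Properties
  using (xor-same; xor-identityʳ; xor-assoc; xor-∧-commutativeRing; ∧-identityʳ; ∧-zeroʳ)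
open import Data.Bool.Solver using (module xor-∧-Solver)
open import Data.Empty using (⊥-elim)
open import Data.Fin.Base as Fin using (Fin; zero; suc; toℕ; fromℕ; inject₁; cast)
import Data.Fin.Properties as Fin
open import Data.Fin.Relation.Unary.Top using (view; ‵fromℕ; ‵inject₁)
open import Data.List.Base using (List; allFin; cartesianProduct; filter; lookup)
open import Data.List.Membership.Propositional using () renaming (_∈_ to _∈ˡ_)
open import Data.List.Membership.Propositional.Properties
  using (∈-filter⁺; ∈-filter⁻; ∈-cartesianProduct⁺; ∈-allFin; ∈-lookup)
import Data.List.Relation.Unary.All as All
open import Data.List.Relation.Unary.AllPairs using (_∷_)
import Data.List.Relation.Unary.Any as Any
open import Data.List.Relation.Unary.Any.Properties using (lookup-index)
open import Data.List.Relation.Unary.Unique.Propositional using (Unique)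
import Data.List.Relation.Unary.Unique.Propositional.Properties as Unique
open import Data.Nat using (ℕ; zero; suc; _≤_; _<_; _<ᵇ_; _+_; _*_; _^_; _/_; ∣_-_∣; z≤n; s≤s)
open import Data.Nat.DivMod using (m*n/n≡m)
import Data.Nat.Properties as ℕ
open import Data.Product using (∃; ∃-syntax; Σ-syntax; _×_; _,_; proj₁; proj₂; map₁)
open import Data.Product.Function.NonDependent.Propositional using (_×-↔_)
open import Data.Sum using (_⊎_; inj₁; inj₂; [_,_]′)
open import Function using (_∘_; _↔_; Inverse; Injection; Injective; Equivalence)
open import Function.Construct.Composition using (_↔-∘_)
open import Function.Construct.Identity using (↔-id)
open import Function.Properties.Inverse using (↔-sym; Inverse⇒Injection)
open import Level using (Level; 0ℓ)
open import Relation.Binary.Construct.Closure.ReflexiveTransitive as Star using (Star; ε; _◅_; _◅◅_)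
import Relation.Binary.Construct.Closure.Equivalence as Eq
open import Relation.Binary.Construct.Closure.Symmetric using (SymClosure; fwd; bwd)
open import Relation.Binary.Construct.Closure.Transitive using (TransClosure; [_]; _∷_)
open import Relation.Binary.Core using (Rel)
open import Relation.Binary.Definitions using (DecidableEquality)
open import Relation.Binary.PropositionalEquality
open import Relation.Nullary using (¬_; yes; no)
open import Relation.Unary using (Pred; Decidable; _∈_; _∉_)

private variable
  ℓ : Level

-- Crossing of walks in the integer lattice.

Point : Set
Point = ℕ × ℕ

row col : Point → ℕ
row = proj₁
col = proj₂

Consecutive : Rel ℕ _
Consecutive a b = b ≡ suc a ⊎ a ≡ suc b

data _~_ : Rel Point 0ℓ where
  horizontal : ∀ {r c c′} → Consecutive c c′ → (r , c) ~ (r , c′)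
  vertical   : ∀ {r r′ c} → Consecutive r r′ → (r , c) ~ (r′ , c)

suc<ᵇ-flip : ∀ a k → (a <ᵇ k) ≡ (suc a <ᵇ k) ⊎ k ≡ suc a
suc<ᵇ-flip a       zero          = inj₁ refl
suc<ᵇ-flip zero    (suc zero)    = inj₂ refl
suc<ᵇ-flip zero    (suc (suc k)) = inj₁ refl
suc<ᵇ-flip (suc a) (suc k) with suc<ᵇ-flip a k
... | inj₁ eq   = inj₁ eq
... | inj₂ refl = inj₂ refl

<ᵇsuc-flip : ∀ k a → (k <ᵇ a) ≡ (k <ᵇ suc a) ⊎ k ≡ a
<ᵇsuc-flip zero    zero    = inj₂ refl
<ᵇsuc-flip zero    (suc a) = inj₁ refl
<ᵇsuc-flip (suc k) zero    = inj₁ refl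
<ᵇsuc-flip (suc k) (suc a) with <ᵇsuc-flip k a
... | inj₁ eq   = inj₁ eq
... | inj₂ refl = inj₂ refl

-- Turns a bit that changes along a unit step into a coordinate shared with an end of that step; a
-- row and a column obtained in this way make a common vertex.
<ᵇ-flipˡ : ∀ {a a′} k → Consecutive a a′ → (a <ᵇ k) ≡ (a′ <ᵇ k) ⊎ (k ≡ a ⊎ k ≡ a′)
<ᵇ-flipˡ {a} k (inj₁ refl) with suc<ᵇ-flip a k
... | inj₁ eq = inj₁ eq
... | inj₂ eq = inj₂ (inj₂ eq)
<ᵇ-flipˡ {_} {a′} k (inj₂ refl) with suc<ᵇ-flip a′ k
... | inj₁ eq = inj₁ (sym eq)
... | inj₂ eq = inj₂ (inj₁ eq)

<ᵇ-flipʳ : ∀ {a a′} k → Consecutive a a′ → (k <ᵇ a) ≡ (k <ᵇ a′) ⊎ (k ≡ a ⊎ k ≡ a′)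
<ᵇ-flipʳ {a} k (inj₁ refl) with <ᵇsuc-flip k a
... | inj₁ eq = inj₁ eq
... | inj₂ eq = inj₂ (inj₁ eq)
<ᵇ-flipʳ {_} {a′} k (inj₂ refl) with <ᵇsuc-flip k a′
... | inj₁ eq = inj₁ (sym eq)
... | inj₂ eq = inj₂ (inj₂ eq)

<⇒<ᵇ≡true : ∀ {m n} → m < n → (m <ᵇ n) ≡ true
<⇒<ᵇ≡true {zero}  (s≤s _)         = refl
<⇒<ᵇ≡true {suc m} (s≤s m<n@(s≤s _)) = <⇒<ᵇ≡true m<n

-- crosses u v b tells whether the step from u to v crosses the ray that
-- leaves b to the right, shifted up by half a unit; sweeps v b b′ tells
-- whether this ray passes over v when its origin moves from b to b′.
crosses sweeps : Point → Point → Point → Bool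
crosses u v b  = ((row u <ᵇ row b) xor (row v <ᵇ row b)) ∧ (col b <ᵇ col u)
sweeps  v b b′ = ((row v <ᵇ row b) xor (row v <ᵇ row b′)) ∧ (col b <ᵇ col v)

Walk : Pred Point ℓ → Rel Point ℓ
Walk A = Star (λ u v → u ~ v × A u × A v)

-- The value at ε accounts for the vertical half-line that continues the walk
-- downwards from its last point, provided that b is not to the right of it.
parity : ∀ {A : Pred Point ℓ} {u v} → Walk A u v → Point → Bool
parity {u = u} ε                  b = row u <ᵇ row b
parity {u = u} (_◅_ {j = v} _ p) b = crosses u v b xor parity p b

parity-top : ∀ {A : Pred Point ℓ} {s t b} (p : Walk A s t) → row b ≡ 0 → parity p b ≡ false
parity-top           ε       refl = refl
parity-top {b = _ , _} (_ ◅ p) refl = parity-top p refl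

-- All row comparisons are true, so no step crosses the ray and only the half-line at the end
-- counts.
parity-below : ∀ {A : Pred Point ℓ} {s t b} (p : Walk A s t) → (∀ {v} → A v → row v < row b) →
  A s → parity p b ≡ true
parity-below ε A<b As = <⇒<ᵇ≡true (A<b As)
parity-below ((_ , _ , Av) ◅ p) A<b As
  rewrite <⇒<ᵇ≡true (A<b As) | <⇒<ᵇ≡true (A<b Av) = parity-below p A<b Av

module _ {A B : Pred Point ℓ} {P : Set ℓ} (meet : ∀ {v} → A v → B v → P) where

  -- Writes the effect of moving `b` as a difference between the two ends of the step, so that it
  -- telescopes along a walk. For two vertical steps this is a regrouping of the four row
  -- comparisons. For perpendicular steps one side is `false`, and so is the other unless a row bit
  -- and a column bit both flip; then an end of one step is an end of the other.
  crosses-sweeps : ∀ {u v b b′} → u ~ v → b ~ b′ → A u → A v → B b → B b′ →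
    crosses u v b xor crosses u v b′ ≡ sweeps u b b′ xor sweeps v b b′ ⊎ P
  crosses-sweeps {r , _} {b = s , _} (horizontal _) (horizontal _) _ _ _ _
    rewrite xor-same (r <ᵇ s) = inj₁ refl
  crosses-sweeps {r , c} {r′ , _} {s , d} {s′ , _} (vertical _) (vertical _) _ _ _ _ =
    inj₁ (solve 5 (λ w x y z t →
      ((w :+ x) :* t) :+ ((y :+ z) :* t) := ((w :+ y) :* t) :+ ((x :+ z) :* t)) refl
      (r <ᵇ s) (r′ <ᵇ s) (r <ᵇ s′) (r′ <ᵇ s′) (d <ᵇ c))
    where open xor-∧-Solver
  crosses-sweeps {r , c} {_ , c′} {s , d} {s′ , _} (horizontal h) (vertical k) Au Av Bb Bb′
    rewrite xor-same (r <ᵇ s) | xor-same (r <ᵇ s′)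
    with <ᵇ-flipʳ r k | <ᵇ-flipʳ d h
  ... | inj₁ eq          | _                rewrite eq | xor-same (r <ᵇ s′) = inj₁ refl
  ... | inj₂ _           | inj₁ eq          rewrite eq =
    inj₁ (sym (xor-same (((r <ᵇ s) xor (r <ᵇ s′)) ∧ (d <ᵇ c′))))
  ... | inj₂ (inj₁ refl) | inj₂ (inj₁ refl) = inj₂ (meet Au Bb)
  ... | inj₂ (inj₁ refl) | inj₂ (inj₂ refl) = inj₂ (meet Av Bb)
  ... | inj₂ (inj₂ refl) | inj₂ (inj₁ refl) = inj₂ (meet Au Bb′)
  ... | inj₂ (inj₂ refl) | inj₂ (inj₂ refl) = inj₂ (meet Av Bb′)
  crosses-sweeps {r , c} {r′ , _} {s , d} {_ , d′} (vertical h) (horizontal k) Au Av Bb Bb′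
    rewrite xor-same (r <ᵇ s) | xor-same (r′ <ᵇ s)
    with <ᵇ-flipˡ s h | <ᵇ-flipˡ c k
  ... | inj₁ eq          | _                rewrite eq | xor-same (r′ <ᵇ s) = inj₁ refl
  ... | inj₂ _           | inj₁ eq          rewrite eq =
    inj₁ (xor-same (((r <ᵇ s) xor (r′ <ᵇ s)) ∧ (d′ <ᵇ c)))
  ... | inj₂ (inj₁ refl) | inj₂ (inj₁ refl) = inj₂ (meet Au Bb)
  ... | inj₂ (inj₁ refl) | inj₂ (inj₂ refl) = inj₂ (meet Au Bb′)
  ... | inj₂ (inj₂ refl) | inj₂ (inj₁ refl) = inj₂ (meet Av Bb)
  ... | inj₂ (inj₂ refl) | inj₂ (inj₂ refl) = inj₂ (meet Av Bb′)

  -- Covers the half-line below `t`. Strictly to the left of `t` the column test in `sweeps` is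
  -- true; in the column of `t` the row comparison flips only if `b` or `b′` is `t`.
  sweeps-rightmost : ∀ {t b b′} → b ~ b′ → col b ≤ col t → A t → B b → B b′ →
    (row t <ᵇ row b) xor (row t <ᵇ row b′) ≡ sweeps t b b′ ⊎ P
  sweeps-rightmost {r , _} {s , _} (horizontal _) _ _ _ _
    rewrite xor-same (r <ᵇ s) = inj₁ refl
  sweeps-rightmost {r , c} {s , d} {s′ , _} (vertical k) d≤c At Bb Bb′
    with ℕ.m≤n⇒m<n∨m≡n d≤c | <ᵇ-flipʳ r k
  ... | inj₁ d<c  | _ rewrite <⇒<ᵇ≡true d<c = inj₁ (sym (∧-identityʳ _))
  ... | inj₂ _    | inj₁ eq rewrite eq | xor-same (r <ᵇ s′) = inj₁ refl
  ... | inj₂ refl | inj₂ (inj₁ refl) = inj₂ (meet At Bb)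
  ... | inj₂ refl | inj₂ (inj₂ refl) = inj₂ (meet At Bb′)

  -- The terms at inner vertices of the walk occur twice and cancel, and the one at `t` cancels
  -- against the half-line, which leaves the one at the start.
  parity-sweeps : ∀ {s t b b′} (p : Walk A s t) → b ~ b′ → col b ≤ col t →
    A s → B b → B b′ → parity p b xor parity p b′ ≡ sweeps s b b′ ⊎ P
  parity-sweeps ε b~b′ b≤t As Bb Bb′ = sweeps-rightmost b~b′ b≤t As Bb Bb′
  parity-sweeps {s} {b = b} {b′} (_◅_ {j = v} (s~v , _ , Av) p) b~b′ b≤t As Bb Bb′
    with crosses-sweeps s~v b~b′ As Av Bb Bb′ | parity-sweeps p b~b′ b≤t Av Bb Bb′
  ... | inj₂ m   | _        = inj₂ m
  ... | inj₁ _   | inj₂ m   = inj₂ m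
  ... | inj₁ eq₁ | inj₁ eq₂ = inj₁ (begin
    (crosses s v b xor parity p b) xor (crosses s v b′ xor parity p b′)
      ≡⟨ interchange (crosses s v b) _ _ _ ⟩
    (crosses s v b xor crosses s v b′) xor (parity p b xor parity p b′)
      ≡⟨ cong₂ _xor_ eq₁ eq₂ ⟩
    (sweeps s b b′ xor sweeps v b b′) xor sweeps v b b′
      ≡⟨ xor-assoc (sweeps s b b′) _ _ ⟩
    sweeps s b b′ xor (sweeps v b b′ xor sweeps v b b′)
      ≡⟨ cong (sweeps s b b′ xor_) (xor-same (sweeps v b b′)) ⟩
    sweeps s b b′ xor false
      ≡⟨ xor-identityʳ _ ⟩
    sweeps s b b′ ∎)
    where
    open ≡-Reasoning
    open CommutativeSemigroupProperties
      (CommutativeRing.+-commutativeSemigroup xor-∧-commutativeRing) using (interchange)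

  parity-constant : ∀ {s t b b′} (p : Walk A s t) → col s ≡ 0 → (∀ {v} → B v → col v ≤ col t) →
    A s → Walk B b b′ → parity p b ≡ parity p b′ ⊎ P
  parity-constant p s≡0 _ As ε = inj₁ refl
  parity-constant {_ , _} {b = b} p refl B≤t As (_◅_ {j = b″} (b~b″ , Bb , Bb″) q)
    with parity-sweeps p b~b″ (B≤t Bb) As Bb Bb″ | parity-constant p refl B≤t As q
  ... | inj₂ m  | _       = inj₂ m
  ... | inj₁ _  | inj₂ m  = inj₂ m
  -- `s` is in column 0, so the column test in `sweeps s b b″` is `false`.
  ... | inj₁ eq | inj₁ e  = inj₁ (trans (xor≡false⇒≡ _ _ (trans eq (∧-zeroʳ _))) e)
    where
    xor≡false⇒≡ : ∀ x y → x xor y ≡ false → x ≡ y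
    xor≡false⇒≡ false false _ = refl
    xor≡false⇒≡ true  true  _ = refl

  lattice-crossing : ∀ {s t s′ t′} → A s → Walk A s t → Walk B s′ t′ →
    col s ≡ 0 → (∀ {v} → B v → col v ≤ col t) →
    row s′ ≡ 0 → (∀ {v} → A v → row v < row t′) → P
  lattice-crossing As p q s≡0 B≤t s′≡0 A<t′ with parity-constant p s≡0 B≤t As q
  ... | inj₂ m  = m
  ... | inj₁ eq
    with () ← trans (sym (parity-top p s′≡0)) (trans eq (parity-below p A<t′ As))

-- A crossing property that minors inherit.

module _ {U : Set} where
  open Digraph

  -- Reflexive outside A too, hence the hypotheses A s and B s′ of Crossing.
  Joined : Digraph U → Pred U 0ℓ → Rel U 0ℓ
  Joined H A = Eq.EqClosure (λ x y → E H x y × A x × A y)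

  -- Speaks of vertex sets rather than of given paths, since sets pull back along a contraction, and
  -- of undirected walks, since a lifted walk may traverse the contracted edge backwards.
  Crossing : Digraph U → (s t s′ t′ : U) → Set₁
  Crossing H s t s′ t′ = ∀ {A B : Pred U 0ℓ} → A s → B s′ →
    Joined H A s t → Joined H B s′ t′ → ∃ λ v → A v × B v

  module _ (_≟_ : DecidableEquality U) {H : Digraph U} where
    open Operations _≟_ H using (rename; identify)

    rename-merged : ∀ a b → rename a b a ≡ b
    rename-merged a b with a ≟ a
    ... | yes _  = refl
    ... | no a≢a = ⊥-elim (a≢a refl)

    rename-kept : ∀ {a b x} → x ≢ a → rename a b x ≡ x
    rename-kept {a} {b} {x} x≢a with x ≟ a
    ... | yes x≡a = ⊥-elim (x≢a x≡a)
    ... | no _    = refl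

    module _ {a b} (Vb : V H b) (b≢a : b ≢ a) (ab : SymClosure (E H) a b) where

      -- The only name that changes is `a`, and the contracted edge joins it to `b`; both ends are
      -- renamed to `b`, so this edge lies in the preimage of `A`.
      Joined-rename : ∀ {A : Pred U 0ℓ} x → A (rename a b x) →
        Joined H (A ∘ rename a b) x (rename a b x)
      Joined-rename {A} x Ax with x ≟ a
      ... | no _ = ε
      ... | yes refl = link ab ◅ ε
        where
        Aa : A (rename a b a)
        Aa = subst A (sym (rename-merged a b)) Ax
        Ab : A (rename a b b)
        Ab = subst A (sym (rename-kept b≢a)) Ax
        link : SymClosure (E H) a b →
          SymClosure (λ x y → E H x y × A (rename a b x) × A (rename a b y)) a b
        link (fwd e) = fwd (e , Aa , Ab)
        link (bwd e) = bwd (e , Ab , Aa)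

      -- Each edge of the contraction stems from an edge of `H` between some `x` and `y`; the lifted
      -- walk goes from the new name of `x` to `x`, over this edge, and on to the new name of `y`.
      Joined-uncontract : ∀ {A : Pred U 0ℓ} {x y} → Joined (identify a b Vb b≢a) A x y →
        Joined H (A ∘ rename a b) x y
      Joined-uncontract {A} = Eq.fold (Eq.isEquivalence _)
        λ { ((_ , x , y , e , refl , refl) , Ax , Ay) →
          Eq.symmetric _ (Joined-rename {A} x Ax) ◅◅ fwd (e , Ax , Ay) ◅ Joined-rename {A} y Ay }

      -- A common vertex of the two preimages is renamed to a common vertex of `A` and `B`. The
      -- starting vertices keep their names, which places them in the preimages.
      Crossing-identify : ∀ {s t s′ t′} → s ≢ a → s′ ≢ a →
        Crossing H s t s′ t′ → Crossing (identify a b Vb b≢a) s t s′ t′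
      Crossing-identify s≢a s′≢a cross {A} {B} As Bs′ p q =
        let v , Av , Bv = cross (subst A (sym (rename-kept s≢a)) As)
                                (subst B (sym (rename-kept s′≢a)) Bs′)
                                (Joined-uncontract p) (Joined-uncontract q)
        in rename a b v , Av , Bv

  module _ (_≟_ : DecidableEquality U) (T : TerminalDigraph U) where
    open Minors _≟_ T
    open TerminalDigraph T using (K)

    ∈∧∉⇒≢ : ∀ {x y} → x ∈ K → y ∉ K → x ≢ y
    ∈∧∉⇒≢ x∈K y∉K refl = y∉K x∈K

    -- Undoing a deletion only adds edges. A contraction can be undone because the name that
    -- vanished is not a terminal's, hence neither `s` nor `s′`.
    Crossing-minor : ∀ {H s t s′ t′} → s ∈ K → s′ ∈ K → IsMinor H →
      Crossing (digraph T) s t s′ t′ → Crossing H s t s′ t′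
    Crossing-minor s∈K s′∈K start cross = cross
    Crossing-minor s∈K s′∈K (delVertex {H} m _ _) cross As Bs′ p q =
      Crossing-minor s∈K s′∈K m cross As Bs′ (Eq.map (map₁ proj₁) p) (Eq.map (map₁ proj₁) q)
    Crossing-minor s∈K s′∈K (delEdge {H} m _) cross As Bs′ p q =
      Crossing-minor s∈K s′∈K m cross As Bs′ (Eq.map (map₁ proj₁) p) (Eq.map (map₁ proj₁) q)
    Crossing-minor s∈K s′∈K (contractₜ {H} m e v∉K) cross =
      Crossing-identify _≟_ {H} (proj₁ (E⇒V H e)) (λ { refl → loopless H e }) (bwd e)
        (∈∧∉⇒≢ s∈K v∉K) (∈∧∉⇒≢ s′∈K v∉K)
        (Crossing-minor s∈K s′∈K m cross)
    Crossing-minor s∈K s′∈K (contractₕ {H} m e u∉K) cross =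
      Crossing-identify _≟_ {H} (proj₂ (E⇒V H e)) (λ { refl → loopless H e }) (fwd e)
        (∈∧∉⇒≢ s∈K u∉K) (∈∧∉⇒≢ s′∈K u∉K)
        (Crossing-minor s∈K s′∈K m cross)

-- Counting grid positions through an index type.

lookup-injective : ∀ {A : Set} {xs : List A} → Unique xs → Injective _≡_ _≡_ (lookup xs)
lookup-injective (_ ∷ _)   {zero}  {zero}  _  = refl
lookup-injective (x∉ ∷ _)  {zero}  {suc j} eq = ⊥-elim (All.lookup x∉ (∈-lookup j) eq)
lookup-injective (x∉ ∷ _)  {suc i} {zero}  eq = ⊥-elim (All.lookup x∉ (∈-lookup i) (sym eq))
lookup-injective (_ ∷ xs!) {suc i} {suc j} eq = cong suc (lookup-injective xs! eq)

module _ {m n N} {I : Set} (I↔N : I ↔ Fin N) (f : I → Position m n)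
         {P : Pred (Position m n) 0ℓ} (P? : Decidable P) where
  private
    elements : List (Position m n)
    elements = filter P? (cartesianProduct (allFin m) (allFin n))

  count-≥ : Injective _≡_ _≡_ f → (∀ i → P (f i)) → N ≤ count P?
  count-≥ f-injective Pf = Fin.injective⇒≤ index-injective
    where
    open Inverse I↔N using (from)
    f∈ : ∀ k → f (from k) ∈ˡ elements
    f∈ k = ∈-filter⁺ P? (∈-cartesianProduct⁺ (∈-allFin _) (∈-allFin _)) (Pf (from k))
    index-injective : Injective _≡_ _≡_ (Any.index ∘ f∈)
    index-injective {k} {l} eq = Injection.injective (Inverse⇒Injection (↔-sym I↔N)) (f-injective
      (trans (lookup-index (f∈ k)) (trans (cong (lookup elements) eq) (sym (lookup-index (f∈ l))))))

  -- The enumeration has no repetitions, so different places of the list hold different positions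
  -- and have different preimages under `f`.
  count-≤ : (∀ {p} → P p → ∃[ i ] f i ≡ p) → count P? ≤ N
  count-≤ P⊆f = Fin.injective⇒≤ to∘index-injective
    where
    open Inverse I↔N using (to)
    preimage : ∀ k → ∃[ i ] f i ≡ lookup elements k
    preimage k = P⊆f (proj₂ (∈-filter⁻ P? {xs = cartesianProduct (allFin m) (allFin n)} (∈-lookup k)))
    to∘index-injective : Injective _≡_ _≡_ (to ∘ proj₁ ∘ preimage)
    to∘index-injective {k} {l} eq =
      lookup-injective (Unique.filter⁺ P? (Unique.cartesianProduct⁺ (Unique.allFin⁺ m) (Unique.allFin⁺ n)))
        (trans (sym (proj₂ (preimage k)))
          (trans (cong f (Injection.injective (Inverse⇒Injection I↔N) eq)) (proj₂ (preimage l))))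

-- Grid walks as lattice walks.

distance≡1⇒Consecutive : ∀ a b → ∣ a - b ∣ ≡ 1 → Consecutive a b
distance≡1⇒Consecutive zero       b    eq = inj₁ eq
distance≡1⇒Consecutive (suc zero) zero eq = inj₂ refl
distance≡1⇒Consecutive (suc a) (suc b) eq with distance≡1⇒Consecutive a b eq
... | inj₁ refl = inj₁ refl
... | inj₂ refl = inj₂ refl

∣n-1+n∣≡1 : ∀ n → ∣ n - suc n ∣ ≡ 1
∣n-1+n∣≡1 zero    = refl
∣n-1+n∣≡1 (suc n) = ∣n-1+n∣≡1 n

module _ {m n : ℕ} where

  point : Position m n → Point
  point (i , j) = toℕ i , toℕ j

  point-injective : Injective _≡_ _≡_ point
  point-injective {i , j} {i′ , j′} eq =
    cong₂ _,_ (Fin.toℕ-injective (cong proj₁ eq)) (Fin.toℕ-injective (cong proj₂ eq))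

  adjacent-cases : ∀ p q → Adjacent p q →
    (proj₁ p ≡ proj₁ q × Consecutive (col (point p)) (col (point q))) ⊎
    (proj₂ p ≡ proj₂ q × Consecutive (row (point p)) (row (point q)))
  adjacent-cases (i , j) (i′ , j′) adj
    with ∣ toℕ i - toℕ i′ ∣ in di | ∣ toℕ j - toℕ j′ ∣ in dj
  ... | zero  | _    = inj₁ (Fin.toℕ-injective (ℕ.∣m-n∣≡0⇒m≡n di) ,
                             distance≡1⇒Consecutive _ _ (trans dj adj))
  ... | suc d | zero = inj₂ (Fin.toℕ-injective (ℕ.∣m-n∣≡0⇒m≡n dj) ,
                             distance≡1⇒Consecutive _ _ (trans di (trans (sym (ℕ.+-identityʳ _)) adj)))
  ... | suc d | suc e with () ← trans (sym (ℕ.+-suc d e)) (ℕ.suc-injective adj)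

  Adjacent-sym : ∀ (p q : Position m n) → Adjacent p q → Adjacent q p
  Adjacent-sym (i , j) (i′ , j′) =
    trans (cong₂ _+_ (ℕ.∣-∣-comm (toℕ i′) (toℕ i)) (ℕ.∣-∣-comm (toℕ j′) (toℕ j)))

  adjacent-right : ∀ i {j j′ : Fin n} → toℕ j′ ≡ suc (toℕ j) → Adjacent {m} (i , j) (i , j′)
  adjacent-right i {j} eq rewrite eq | ℕ.∣n-n∣≡0 (toℕ i) = ∣n-1+n∣≡1 (toℕ j)

  adjacent-down : ∀ {i i′ : Fin m} j → toℕ i′ ≡ suc (toℕ i) → Adjacent {_} {n} (i , j) (i′ , j)
  adjacent-down {i} j eq rewrite eq | ℕ.∣n-n∣≡0 (toℕ j) =
    trans (ℕ.+-identityʳ _) (∣n-1+n∣≡1 (toℕ i))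

  adjacent⇒~ : ∀ p q → Adjacent p q → point p ~ point q
  adjacent⇒~ p q adj with adjacent-cases p q adj
  ... | inj₁ (refl , c) = horizontal c
  ... | inj₂ (refl , c) = vertical c

  module _ {G : Digraph (Position m n)} (adjacent : ∀ {p q} → Digraph.E G p q → Adjacent p q) where

    grid-crossing : ∀ {s t s′ t′} →
      toℕ (proj₂ s) ≡ 0 → suc (toℕ (proj₂ t)) ≡ n →
      toℕ (proj₁ s′) ≡ 0 → suc (toℕ (proj₁ t′)) ≡ m →
      Crossing G s t s′ t′
    -- The walk in B is continued by one step to the row below the grid, so
    -- that it ends below every vertex of A.
    grid-crossing {s} {t} {s′} {t′} s-left t-right s′-top t′-bottom {A} {B} As Bs′ p q =
      lattice-crossing meet (s , As , refl) (walk p)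
        (Star.map (λ (e , x , y) → e , inj₁ x , inj₁ y) (walk q) ◅◅
          (vertical (inj₁ refl) , inj₁ (t′ , Bt′ q Bs′ , refl) , inj₂ refl) ◅ ε)
        s-left B≤t s′-top A<below
      where
      Image : Pred (Position m n) 0ℓ → Pred Point 0ℓ
      Image C u = ∃[ x ] C x × point x ≡ u

      below : Point
      below = suc (toℕ (proj₁ t′)) , toℕ (proj₂ t′)

      walk : ∀ {C x y} → Joined G C x y → Walk (Image C) (point x) (point y)
      walk = Star.gmap point λ
        { {x} {y} (fwd (e , Cx , Cy)) →
            adjacent⇒~ x y (adjacent e) , (_ , Cx , refl) , (_ , Cy , refl)
        ; {x} {y} (bwd (e , Cy , Cx)) →
            adjacent⇒~ x y (Adjacent-sym y x (adjacent e)) , (_ , Cx , refl) , (_ , Cy , refl) }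

      Bt′ : ∀ {x y} → Joined G B x y → B x → B y
      Bt′ ε                       Bx = Bx
      Bt′ (fwd (_ , _ , By) ◅ xs) _  = Bt′ xs By
      Bt′ (bwd (_ , By , _) ◅ xs) _  = Bt′ xs By

      A<below : ∀ {u} → Image A u → row u < row below
      A<below ((i , _) , _ , refl) = subst (toℕ i <_) (sym t′-bottom) (Fin.toℕ<n i)

      B≤t : ∀ {u} → Image B u ⊎ u ≡ below → col u ≤ toℕ (proj₂ t)
      B≤t (inj₁ ((_ , j) , _ , refl)) = ℕ.≤-pred (subst (toℕ j <_) (sym t-right) (Fin.toℕ<n j))
      B≤t (inj₂ refl) = ℕ.≤-pred (subst (toℕ (proj₂ t′) <_) (sym t-right) (Fin.toℕ<n (proj₂ t′)))

      -- A common lattice point is a common vertex because `point` is injective; the added point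
      -- `below` is under every vertex of `A`.
      meet : ∀ {u} → Image A u → Image B u ⊎ u ≡ below → ∃ λ v → A v × B v
      meet (x , Ax , x≡u) (inj₁ (y , By , y≡u)) =
        x , Ax , subst B (point-injective (trans y≡u (sym x≡u))) By
      meet Au (inj₂ refl) = ⊥-elim (ℕ.<-irrefl refl (A<below Au))

-- Directed paths and their vertices.

module _ {U : Set} (H : Digraph U) where
  open Digraph H using (V; E; E⇒V)

  -- Stands in for the vertex set of a single path: it contains every path from `s` to `t`, and at a
  -- common vertex of two such sets the paths can be spliced.
  Between : U → U → Pred U 0ℓ
  Between s t v = Reachable H s v × Reachable H v t

  path-Joined : ∀ {s t} → Reachable H s t → Joined H (Between s t) s t
  path-Joined = from ε
    where
    -- The first argument accumulates the path already travelled, which certifies that each vertex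
    -- is reachable from `s`.
    from : ∀ {s t x} → Reachable H s x → Reachable H x t → Joined H (Between s t) x t
    from before ε       = ε
    from before (e ◅ p) =
      fwd (e , (before , e ◅ p) , (before ◅◅ e ◅ ε , p)) ◅ from (before ◅◅ e ◅ ε) p

  Reachable-V : ∀ {x y} → V x → Reachable H x y → V y
  Reachable-V Vx ε       = Vx
  Reachable-V _  (e ◅ p) = Reachable-V (proj₂ (E⇒V e)) p

-- Consecutive indices.

Successor : ∀ {n} → Rel (Fin n) 0ℓ
Successor i j = toℕ j ≡ suc (toℕ i)

climb : ∀ {n} {i j : Fin n} → i Fin.≤ j → Star Successor i j
climb {i = zero}  {zero}        _         = ε
climb {i = zero}  {suc zero}    _         = refl ◅ ε
climb {i = zero}  {suc (suc j)} _         = refl ◅ Star.gmap suc (cong suc) (climb {i = zero} {suc j} z≤n)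
climb {i = suc _} {suc _}       (s≤s i≤j) = Star.gmap suc (cong suc) (climb i≤j)

-- The only consistent case is `i` first and `j` last with nothing between them; the others put an
-- index before the first or after the last one.
consecutive-extremes : ∀ {n} {i j : Fin n} → Successor i j → Extreme i → Extreme j → n ≡ 2
consecutive-extremes i+1≡j _          (inj₁ j≡0) with () ← trans (sym i+1≡j) j≡0
consecutive-extremes i+1≡j (inj₁ i≡0) (inj₂ eq)  = trans (sym eq) (cong suc (trans i+1≡j (cong suc i≡0)))
consecutive-extremes i+1≡j (inj₂ eq)  (inj₂ eq′) =
  ⊥-elim (ℕ.1+n≢n (trans (sym i+1≡j) (ℕ.suc-injective (trans eq′ (sym eq)))))

-- The terminals of the grid.

module Grid (r : ℕ) where

  Vertex : Set
  Vertex = Position (r + 2) (r + 2)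

  G : Digraph Vertex
  G = digraph (𝔾 r)

  open Digraph G using (E)

  2+r≡r+2 : 2 + r ≡ r + 2
  2+r≡r+2 = ℕ.+-comm 2 r

  -- Both `side` and `inner` are built in `Fin (2 + r)`, whose constructors split off the first
  -- index, and then cast. Indexing the two ends by `Fin 2` lets the four sides be counted together.
  side : Fin 2 → Fin (r + 2)
  side zero    = cast 2+r≡r+2 zero
  side (suc _) = cast 2+r≡r+2 (fromℕ (suc r))

  inner : Fin r → Fin (r + 2)
  inner k = cast 2+r≡r+2 (suc (inject₁ k))

  first last : Fin (r + 2)
  first = side zero
  last  = side (suc zero)

  toℕ-first : toℕ first ≡ 0
  toℕ-first = Fin.toℕ-cast 2+r≡r+2 zero

  suc-toℕ-last : suc (toℕ last) ≡ r + 2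
  suc-toℕ-last = trans (cong suc (trans (Fin.toℕ-cast _ (fromℕ (suc r))) (Fin.toℕ-fromℕ (suc r)))) 2+r≡r+2

  toℕ-inner : ∀ k → toℕ (inner k) ≡ suc (toℕ k)
  toℕ-inner k = trans (Fin.toℕ-cast _ (suc (inject₁ k))) (cong suc (Fin.toℕ-inject₁ k))

  cast-injective : Injective _≡_ _≡_ (cast 2+r≡r+2)
  cast-injective {i} {j} eq = Fin.toℕ-injective
    (trans (sym (Fin.toℕ-cast 2+r≡r+2 i)) (trans (cong toℕ eq) (Fin.toℕ-cast 2+r≡r+2 j)))

  inner-injective : Injective _≡_ _≡_ inner
  inner-injective = Fin.inject₁-injective ∘ Fin.suc-injective ∘ cast-injective

  side-injective : Injective _≡_ _≡_ side
  side-injective {zero}     {zero}     _  = refl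
  side-injective {suc zero} {suc zero} _  = refl
  side-injective {zero}     {suc zero} eq with () ← cast-injective eq
  side-injective {suc zero} {zero}     eq with () ← cast-injective eq

  side-extreme : ∀ e → Extreme (side e)
  side-extreme zero       = inj₁ toℕ-first
  side-extreme (suc zero) = inj₂ suc-toℕ-last

  inner-¬extreme : ∀ k → ¬ Extreme (inner k)
  inner-¬extreme k (inj₁ eq) with () ← trans (sym (toℕ-inner k)) eq
  inner-¬extreme k (inj₂ eq) = ℕ.<⇒≢ (Fin.toℕ<n k) (ℕ.suc-injective (ℕ.suc-injective
    (trans (cong suc (sym (toℕ-inner k))) (trans eq (sym 2+r≡r+2)))))

  inner≢side : ∀ {k e} → inner k ≢ side e
  inner≢side {k} {e} eq = inner-¬extreme k (subst Extreme (sym eq) (side-extreme e))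

  side-or-inner : ∀ i → (∃[ e ] side e ≡ i) ⊎ (∃[ k ] inner k ≡ i)
  side-or-inner i = subst (λ i → (∃[ e ] side e ≡ i) ⊎ (∃[ k ] inner k ≡ i))
    (Fin.cast-involutive 2+r≡r+2 (sym 2+r≡r+2) i) (cases (cast (sym 2+r≡r+2) i))
    where
    cases : ∀ j → (∃[ e ] side e ≡ cast 2+r≡r+2 j) ⊎ (∃[ k ] inner k ≡ cast 2+r≡r+2 j)
    cases zero = inj₁ (zero , refl)
    cases (suc j) with view j
    ... | ‵fromℕ     = inj₁ (suc zero , refl)
    ... | ‵inject₁ k = inj₂ (k , refl)

  TerminalIndex : Set
  TerminalIndex = (Fin 2 × Fin 2) × Fin r

  terminal : TerminalIndex → Vertex
  terminal ((zero  , e) , k) = inner k , side e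
  terminal ((suc _ , e) , k) = side e , inner k

  terminal-injective : Injective _≡_ _≡_ terminal
  terminal-injective {(zero , e) , k} {(zero , e′) , k′} eq =
    cong₂ (λ e k → (zero , e) , k) (side-injective (cong proj₂ eq)) (inner-injective (cong proj₁ eq))
  terminal-injective {(suc zero , e) , k} {(suc zero , e′) , k′} eq =
    cong₂ (λ e k → (suc zero , e) , k) (side-injective (cong proj₁ eq)) (inner-injective (cong proj₂ eq))
  terminal-injective {(zero     , e) , k} {(suc zero , e′) , k′} eq =
    ⊥-elim (inner≢side {k} {e′} (cong proj₁ eq))
  terminal-injective {(suc zero , e) , k} {(zero     , e′) , k′} eq =
    ⊥-elim (inner≢side {k} {e′} (cong proj₂ eq))

  terminal-Terminal : ∀ x → Terminal r (terminal x)
  terminal-Terminal ((zero  , e) , k) = inj₂ (side-extreme e) , inner-¬extreme k ∘ proj₁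
  terminal-Terminal ((suc _ , e) , k) = inj₁ (side-extreme e) , inner-¬extreme k ∘ proj₂

  terminal-surjective : ∀ {p} → Terminal r p → ∃[ x ] terminal x ≡ p
  terminal-surjective {i , j} (b , ¬c) with side-or-inner i | side-or-inner j
  ... | inj₁ (e , refl) | inj₁ (e′ , refl) = ⊥-elim (¬c (side-extreme e , side-extreme e′))
  ... | inj₁ (e , refl) | inj₂ (k  , refl) = ((suc zero , e) , k) , refl
  ... | inj₂ (k , refl) | inj₁ (e  , refl) = ((zero , e) , k) , refl
  ... | inj₂ (k , refl) | inj₂ (l  , refl) = ⊥-elim ([ inner-¬extreme k , inner-¬extreme l ]′ b)

  TerminalIndex↔ : TerminalIndex ↔ Fin (4 * r)
  TerminalIndex↔ = ↔-sym Fin.*↔× ↔-∘ (↔-sym (Fin.*↔× {2} {2}) ×-↔ ↔-id _)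

  #terminals≡4r : #terminals (𝔾 r) ≡ 4 * r
  #terminals≡4r = ℕ.≤-antisym
    (count-≤ TerminalIndex↔ terminal (TerminalDigraph.K? (𝔾 r)) terminal-surjective)
    (count-≥ TerminalIndex↔ terminal (TerminalDigraph.K? (𝔾 r)) terminal-injective terminal-Terminal)

  -- Monotonicity, acyclicity and straight paths in the grid.

  E-monotone : ∀ {p q} → E p q → (proj₁ p Fin.≤ proj₁ q) × (proj₂ p Fin.≤ proj₂ q)
  E-monotone (_ , _ , inj₁ (refl , j<j′) , _) = ℕ.≤-refl , ℕ.<⇒≤ j<j′
  E-monotone (_ , _ , inj₂ (refl , i<i′) , _) = ℕ.<⇒≤ i<i′ , ℕ.≤-refl

  Reachable-monotone : ∀ {p q} → Reachable G p q → (proj₁ p Fin.≤ proj₁ q) × (proj₂ p Fin.≤ proj₂ q)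
  Reachable-monotone ε       = ℕ.≤-refl , ℕ.≤-refl
  Reachable-monotone (e ◅ p) with i≤ , j≤ ← E-monotone e | i′≤ , j′≤ ← Reachable-monotone p =
    ℕ.≤-trans i≤ i′≤ , ℕ.≤-trans j≤ j′≤

  -- The antidiagonal of the vertex, a potential that excludes both directed cycles and pairs of
  -- opposite edges.
  rank : Vertex → ℕ
  rank (i , j) = toℕ i + toℕ j

  E-rank : ∀ {p q} → E p q → rank p < rank q
  E-rank {i , _} (_ , _ , inj₁ (refl , j<j′) , _) = ℕ.+-monoʳ-< (toℕ i) j<j′
  E-rank {_ , j} (_ , _ , inj₂ (refl , i<i′) , _) = ℕ.+-monoˡ-< (toℕ j) i<i′

  acyclic : Acyclic G
  acyclic p cycle = ℕ.<-irrefl refl (E⁺-rank cycle)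
    where
    E⁺-rank : ∀ {p q} → TransClosure E p q → rank p < rank q
    E⁺-rank [ e ]     = E-rank e
    E⁺-rank (e ∷ e⁺) = ℕ.<-trans (E-rank e) (E⁺-rank e⁺)

  isDirectedGrid : IsDirectedGrid G
  isDirectedGrid = record
    { adjacent = λ (_ , adj , _) → adj
    ; oriented = λ e e′ → ℕ.<-asym (E-rank e) (E-rank e′)
    ; interior = λ ¬b (c , _) → ¬b (inj₁ c)
    ; complete = complete
    }
    where
    complete : ∀ {p q} → ¬ Corner p → ¬ Corner q → Adjacent p q →
      ¬ (Boundary p × Boundary q) → E p q ⊎ E q p
    complete {i , j} {i′ , j′} ¬cp ¬cq adj ¬b with adjacent-cases (i , j) (i′ , j′) adj
    ... | inj₁ (refl , inj₁ eq) = inj₁ ((¬cp , ¬cq) , adj ,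
      inj₁ (refl , ℕ.≤-reflexive (sym eq)) , λ (tp , tq) → ¬b (proj₁ tp , proj₁ tq))
    ... | inj₁ (refl , inj₂ eq) = inj₂ ((¬cq , ¬cp) , Adjacent-sym (i , j) (i , j′) adj ,
      inj₁ (refl , ℕ.≤-reflexive (sym eq)) , λ (tq , tp) → ¬b (proj₁ tp , proj₁ tq))
    ... | inj₂ (refl , inj₁ eq) = inj₁ ((¬cp , ¬cq) , adj ,
      inj₂ (refl , ℕ.≤-reflexive (sym eq)) , λ (tp , tq) → ¬b (proj₁ tp , proj₁ tq))
    ... | inj₂ (refl , inj₂ eq) = inj₂ ((¬cq , ¬cp) , Adjacent-sym (i , j) (i′ , j) adj ,
      inj₂ (refl , ℕ.≤-reflexive (sym eq)) , λ (tq , tp) → ¬b (proj₁ tp , proj₁ tq))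

  first≤last : first Fin.≤ last
  first≤last = subst (_≤ toℕ last) (sym toℕ-first) z≤n

  ¬consecutive-extremes : ∀ {i j} → Fin r → Successor i j → Extreme i → ¬ Extreme j
  ¬consecutive-extremes k i+1≡j ei ej =
    -- A side of length `r + 2 ≡ 2` would make `k` an element of `Fin 0`.
    Fin.¬Fin0 (subst Fin (ℕ.+-cancelʳ-≡ 2 r 0 (consecutive-extremes i+1≡j ei ej)) k)

  -- No edge of an inner row is among the deleted ones: both its ends would have to lie in extreme
  -- columns.
  row-path : ∀ k → Reachable G (inner k , first) (inner k , last)
  row-path k = Star.gmap (inner k ,_) edge (climb first≤last)
    where
    edge : ∀ {j j′} → Successor j j′ → E (inner k , j) (inner k , j′)
    edge {j} {j′} eq =
      (inner-¬extreme k ∘ proj₁ , inner-¬extreme k ∘ proj₁) ,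
      adjacent-right (inner k) {j} {j′} eq ,
      inj₁ (refl , ℕ.≤-reflexive (sym eq)) ,
      λ { ((inj₁ b , _) , _)               → inner-¬extreme k b
        ; ((inj₂ _ , _) , (inj₁ b , _))    → inner-¬extreme k b
        ; ((inj₂ ej , _) , (inj₂ ej′ , _)) → ¬consecutive-extremes k eq ej ej′ }

  column-path : ∀ k → Reachable G (first , inner k) (last , inner k)
  column-path k = Star.gmap (_, inner k) edge (climb first≤last)
    where
    edge : ∀ {i i′} → Successor i i′ → E (i , inner k) (i′ , inner k)
    edge {i} {i′} eq =
      (inner-¬extreme k ∘ proj₂ , inner-¬extreme k ∘ proj₂) ,
      adjacent-down {i = i} {i′} (inner k) eq ,
      inj₂ (refl , ℕ.≤-reflexive (sym eq)) ,
      λ { ((inj₂ b , _) , _)               → inner-¬extreme k b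
        ; ((inj₁ _ , _) , (inj₂ b , _))    → inner-¬extreme k b
        ; ((inj₁ ei , _) , (inj₁ ei′ , _)) → ¬consecutive-extremes k eq ei ei′ }

  left right top bottom : Fin r → TerminalIndex
  left   k = (zero , zero) , k
  right  k = (zero , suc zero) , k
  top    k = (suc zero , zero) , k
  bottom k = (suc zero , suc zero) , k

  -- Meeting points in a reachability-preserving minor.

  module _ (H : Digraph Vertex) (H-minor : IsReachabilityPreservingMinor (𝔾 r) H) where
    open IsReachabilityPreservingMinor (𝔾 r) H-minor

    reach-H : ∀ x y → Reachable G (terminal x) (terminal y) → Reachable H (terminal x) (terminal y)
    reach-H x y = Equivalence.from (reachable (terminal-Terminal x) (terminal-Terminal y))

    -- After contractions an edge of `H` may go left or up; only between terminals is reachability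
    -- known to agree with the grid.
    H-monotone : ∀ {p q} → Terminal r p → Terminal r q → Reachable H p q →
      (proj₁ p Fin.≤ proj₁ q) × (proj₂ p Fin.≤ proj₂ q)
    H-monotone Kp Kq = Reachable-monotone ∘ Equivalence.to (reachable Kp Kq)

    terminal-monotone : ∀ x y → Reachable H (terminal x) (terminal y) →
      (proj₁ (terminal x) Fin.≤ proj₁ (terminal y)) × (proj₂ (terminal x) Fin.≤ proj₂ (terminal y))
    terminal-monotone x y = H-monotone (terminal-Terminal x) (terminal-Terminal y)

    Row Column : Fin r → Pred Vertex 0ℓ
    Row    i = Between H (terminal (left i)) (terminal (right i))
    Column j = Between H (terminal (top j)) (terminal (bottom j))

    meeting : ∀ i j → ∃[ v ] Row i v × Column j v
    meeting i j =
      Crossing-minor _≟ₚ_ (𝔾 r) (terminal-Terminal (left i)) (terminal-Terminal (top j)) isMinor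
        (grid-crossing {G = G} (λ (_ , adj , _) → adj) toℕ-first suc-toℕ-last toℕ-first suc-toℕ-last)
        -- The two pairs show that each path starts inside its own set.
        (ε , left⇝right) (ε , top⇝bottom) (path-Joined H left⇝right) (path-Joined H top⇝bottom)
      where
      left⇝right : Reachable H (terminal (left i)) (terminal (right i))
      left⇝right = reach-H (left i) (right i) (row-path i)
      top⇝bottom : Reachable H (terminal (top j)) (terminal (bottom j))
      top⇝bottom = reach-H (top j) (bottom j) (column-path j)

    -- Changing over at `v` leads from the left end of either row to the right end of the other, so
    -- monotonicity gives both inequalities.
    Row-disjoint : ∀ {i i′ v} → Row i v → Row i′ v → i ≡ i′
    Row-disjoint {i} {i′} (l⇝v , v⇝r) (l′⇝v , v⇝r′) = inner-injective (Fin.≤-antisym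
      (proj₁ (terminal-monotone (left i) (right i′) (l⇝v ◅◅ v⇝r′)))
      (proj₁ (terminal-monotone (left i′) (right i) (l′⇝v ◅◅ v⇝r))))

    Column-disjoint : ∀ {j j′ v} → Column j v → Column j′ v → j ≡ j′
    Column-disjoint {j} {j′} (t⇝v , v⇝b) (t′⇝v , v⇝b′) = inner-injective (Fin.≤-antisym
      (proj₂ (terminal-monotone (top j) (bottom j′) (t⇝v ◅◅ v⇝b′)))
      (proj₂ (terminal-monotone (top j′) (bottom j) (t′⇝v ◅◅ v⇝b))))

    -- A terminal between the two ends of a row is squeezed into that row, and likewise for the
    -- column; but an inner row and an inner column cross off the boundary.
    Row∩Column-nonTerminal : ∀ {i j v} → Row i v → Column j v → ¬ Terminal r v
    Row∩Column-nonTerminal {i} {j} {v} (l⇝v , v⇝r) (t⇝v , v⇝b) Kv =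
      [ inner-¬extreme i ∘ subst Extreme row≡ , inner-¬extreme j ∘ subst Extreme column≡ ]′ (proj₁ Kv)
      where
      row≡ : proj₁ v ≡ inner i
      row≡ = Fin.≤-antisym (proj₁ (H-monotone Kv (terminal-Terminal (right i)) v⇝r))
                           (proj₁ (H-monotone (terminal-Terminal (left i)) Kv l⇝v))
      column≡ : proj₂ v ≡ inner j
      column≡ = Fin.≤-antisym (proj₂ (H-monotone Kv (terminal-Terminal (bottom j)) v⇝b))
                              (proj₂ (H-monotone (terminal-Terminal (top j)) Kv t⇝v))

    r²≤#nonTerminals : r ^ 2 ≤ #nonTerminals (𝔾 r) H
    -- `r ^ 2` unfolds to `r * (r * 1)`, whereas the pairs of indices number `r * r`.
    r²≤#nonTerminals = subst (_≤ #nonTerminals (𝔾 r) H) (cong (r *_) (sym (ℕ.*-identityʳ r)))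
      (count-≥ (↔-sym Fin.*↔×) crossing _ crossing-injective crossing-nonTerminal)
      where
      crossing : Fin r × Fin r → Vertex
      crossing (i , j) = proj₁ (meeting i j)

      crossing-injective : Injective _≡_ _≡_ crossing
      crossing-injective {i , j} {i′ , j′} eq with meeting i j | meeting i′ j′
      crossing-injective refl | _ , R , C | _ , R′ , C′ =
        cong₂ _,_ (Row-disjoint R R′) (Column-disjoint C C′)

      crossing-nonTerminal : ∀ ij → Digraph.V H (crossing ij) × ¬ Terminal r (crossing ij)
      crossing-nonTerminal (i , j) with _ , R , C ← meeting i j =
        -- `Reachable` is reflexive at every name, so membership in `H` is derived from the left
        -- terminal, which is kept.
        Reachable-V H (K⊆V (terminal-Terminal (left i))) (proj₁ R) ,
        Row∩Column-nonTerminal R C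

open Grid

-- From `r` to the number of terminals.

4r/4≡r : ∀ r → 4 * r / 4 ≡ r
4r/4≡r r = trans (cong (_/ 4) (ℕ.*-comm 4 r)) (m*n/n≡m r 4)

[4n]²≡16n² : ∀ n → (4 * n) ^ 2 ≡ 16 * n ^ 2
[4n]²≡16n² n =
  trans (cong (4 * n *_) (ℕ.*-assoc 4 n 1)) (ℕ.[m*n]*[o*p]≡[m*o]*[n*p] 4 n 4 (n * 1))

theorem1p3 : (∀ r → 1 ≤ r →
    let k = 4 * r in
    #terminals (𝔾 r) ≡ k
    × Acyclic (digraph (𝔾 r))
    × r ^ 2 ≡ (k / 4) ^ 2
    × (∀ H → IsReachabilityPreservingMinor (𝔾 r) H → r ^ 2 ≤ #nonTerminals (𝔾 r) H))
    × (∃[ C ] ∀ N → ∃[ k ] N ≤ k × (∃[ m ] ∃[ n ] Σ[ T ∈ TerminalDigraph (Position m n) ]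
    #terminals T ≡ k
    × Acyclic (digraph T)
    × IsDirectedGrid (digraph T)
    × (∀ H → IsReachabilityPreservingMinor T H → k ^ 2 ≤ C * #nonTerminals T H)))
theorem1p3 =
  (λ r _ → #terminals≡4r r , acyclic r , cong (_^ 2) (sym (4r/4≡r r)) , r²≤#nonTerminals r) ,
  -- The grid with parameter `N` has `k = 4 * N` terminals, which is at least `N`; the constant 16
  -- comes from squaring the factor 4.
  16 , λ N → 4 * N , ℕ.m≤n*m N 4 , N + 2 , N + 2 , 𝔾 N ,
  #terminals≡4r N , acyclic N , isDirectedGrid N , λ H H-minor →
  ℕ.≤-trans (ℕ.≤-reflexive ([4n]²≡16n² N)) (ℕ.*-monoʳ-≤ 16 (r²≤#nonTerminals N H H-minor))
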